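{- $\mathrm{NDC}^{\oplus}=\mathcal D_T$; in particular also $\mathrm{LV}^{\oplus}=\mathrm{LVf}^{\oplus}=\mathcal D_T$.
   Context: Types $\sigma,\tau::=\mathbb N\mid\sigma\to\tau\mid\sigma\times\tau$; $T^{\oplus}$ terms $M,N::=x\mid\lambda x.M\mid MN\mid\langle M,N\rangle\mid\pi_1\mid\pi_2\mid\mathtt{rec}\mid\mathtt 0\mid\mathtt S\mid M\oplus N$, simply typed with $\mathtt 0:\mathbb N$, $\mathtt S:\mathbb N\to\mathbb N$, $\mathtt{rec}:(\sigma\times(\mathbb N\to\sigma\to\sigma)\times\mathbb N)\to\sigma$, $\pi_1:(\sigma\times\tau)\to\sigma$, $\pi_2:(\sigma\times\tau)\to\tau$, $M\oplus N:\sigma$ if $M,N:\sigma$; Gödel's System T is the fragment without $\oplus$. Numerals $\mathbf 0=\mathtt 0$, $\mathbf{n+1}=\mathtt S\mathbf n$. Values: closed terms of $V,W::=\lambda x.M\mid\pi_1\mid\pi_2\mid\langle V,W\rangle\mid\mathtt{rec}\mid\mathtt 0\mid\mathtt S\mid\mathtt SV$. Weak call-by-value reduction to (sub)distributions: $(\lambda x.M)V\to\{M[V/x]\}$; if $M\to\mu$ then $MV\to\mu V$ (pushforward); if $N\to\nu$ then $MN\to M\nu$; pairs left then right; $\mathtt{rec}\langle U,V,\mathtt 0\rangle\to\{U\}$; $\mathtt{rec}\langle U,V,\mathtt S\mathbf n\rangle\to\{V\mathbf n(\mathtt{rec}\langle U,V,\mathbf n\rangle)\}$; $\pi_i$ project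 pairs of values; $M\oplus N\to\frac12\{M\}+\frac12\{N\}$; lifted to distributions. Evaluation $[\![M]\!](V)=\lim_k\mu_k(V)$, $\mu_0=\{M\}$, $\mu_{k+1}$ the reduct of $\mu_k$. $\mathcal D_T$: the $f:\mathbb N\to\mathbb N$ such that some closed System T term $M:\mathbb N\to\mathbb N$ reduces $M\mathbf n$ to $\mathbf{f(n)}$ for all $n$. For $f:\mathbb N\to\mathbb N$, say a closed $M:\mathbb N\to\mathbb N$ in $T^{\oplus}$ Las-Vegas-computes $f$ with success $p_n$ if for all $n$, $[\![M\mathbf n]\!]$ assigns probability $p_n$ to $\mathtt S\,\mathbf{f(n)}$ and $1-p_n$ to $\mathtt 0$. $\mathrm{LV}^{\oplus}$: $f$ such that some such $M$ has $p_n\ge\frac13$ for all $n$; $\mathrm{NDC}^{\oplus}$: $p_n>0$ for all $n$; $\mathrm{LVf}^{\oplus}$: $p_n\ge\frac1{h(n)}$ for all $n$, for some $h\in\mathcal D_T$ (with $h(n)\ne0$). -}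

module Defs where

open import Data.Nat as ℕ using (ℕ; zero; suc; _≟_)
open import Data.Integer using (+_)
open import Data.Rational using (ℚ; 0ℚ; 1ℚ; ½; _+_; _*_; _-_; _≤_; _<_; _/_)
open import Data.Bool using (Bool; true; false; _∧_; if_then_else_)
open import Data.Maybe using (Maybe; just; nothing)
open import Data.Maybe.Properties using () renaming (≡-dec to maybe-≡-dec)
open import Data.List using (List; []; _∷_; map; concatMap)
open import Data.Product using (_×_; _,_; Σ; ∃; ∃-syntax)
open import Relation.Binary.PropositionalEquality using (_≡_; _≢_)
open import Relation.Nullary using (yes; no; ¬_)
open import Function.Bundles using (_⇔_)

infixr 30 _⇒_
infixr 40 _⊗_

data Ty : Set where
  nat : Ty
  _⇒_ : Ty → Ty → Ty
  _⊗_ : Ty → Ty → Ty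

Var : Set
Var = ℕ

data Term : Set where
  var  : Var → Term
  lam  : Var → Term → Term
  app  : Term → Term → Term
  pair : Term → Term → Term
  π₁ π₂ recT zeroT sucT : Term
  _⊕_  : Term → Term → Term

num : ℕ → Term
num zero    = zeroT
num (suc n) = app sucT (num n)

Ctx : Set
Ctx = List (Var × Ty)

data _∋_∶_ : Ctx → Var → Ty → Set where
  here  : ∀ {Γ x σ} → ((x , σ) ∷ Γ) ∋ x ∶ σ
  there : ∀ {Γ x y σ τ} → x ≢ y → Γ ∋ x ∶ σ → ((y , τ) ∷ Γ) ∋ x ∶ σ

infix 4 _⊢_∶_
data _⊢_∶_ : Ctx → Term → Ty → Set where
  ⊢var  : ∀ {Γ x σ} → Γ ∋ x ∶ σ → Γ ⊢ var x ∶ σ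
  ⊢lam  : ∀ {Γ x M σ τ} → ((x , σ) ∷ Γ) ⊢ M ∶ τ → Γ ⊢ lam x M ∶ σ ⇒ τ
  ⊢app  : ∀ {Γ M N σ τ} → Γ ⊢ M ∶ σ ⇒ τ → Γ ⊢ N ∶ σ → Γ ⊢ app M N ∶ τ
  ⊢pair : ∀ {Γ M N σ τ} → Γ ⊢ M ∶ σ → Γ ⊢ N ∶ τ → Γ ⊢ pair M N ∶ σ ⊗ τ
  ⊢π₁   : ∀ {Γ σ τ} → Γ ⊢ π₁ ∶ (σ ⊗ τ) ⇒ σ
  ⊢π₂   : ∀ {Γ σ τ} → Γ ⊢ π₂ ∶ (σ ⊗ τ) ⇒ τ
  ⊢rec  : ∀ {Γ σ} → Γ ⊢ recT ∶ (σ ⊗ (nat ⇒ σ ⇒ σ) ⊗ nat) ⇒ σ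
  ⊢zero : ∀ {Γ} → Γ ⊢ zeroT ∶ nat
  ⊢suc  : ∀ {Γ} → Γ ⊢ sucT ∶ nat ⇒ nat
  ⊢⊕    : ∀ {Γ M N σ} → Γ ⊢ M ∶ σ → Γ ⊢ N ∶ σ → Γ ⊢ M ⊕ N ∶ σ

-- System T = the ⊕-free fragment
choiceFree : Term → Bool
choiceFree (var x)    = true
choiceFree (lam x M)  = choiceFree M
choiceFree (app M N)  = choiceFree M ∧ choiceFree N
choiceFree (pair M N) = choiceFree M ∧ choiceFree N
choiceFree π₁         = true
choiceFree π₂         = true
choiceFree recT       = true
choiceFree zeroT      = true
choiceFree sucT       = true
choiceFree (M ⊕ N)    = false

-- Values and substitution (of closed values, hence capture-free)

isVal : Term → Bool
isVal (lam x M)       = true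
isVal π₁              = true
isVal π₂              = true
isVal (pair V W)      = isVal V ∧ isVal W
isVal recT            = true
isVal zeroT           = true
isVal sucT            = true
isVal (app sucT V)    = isVal V
isVal _               = false

_[_/_] : Term → Term → Var → Term
var y [ V / x ] with y ≟ x
... | yes _ = V
... | no  _ = var y
lam y M [ V / x ] with y ≟ x
... | yes _ = lam y M
... | no  _ = lam y (M [ V / x ])
app M N [ V / x ]  = app (M [ V / x ]) (N [ V / x ])
pair M N [ V / x ] = pair (M [ V / x ]) (N [ V / x ])
π₁ [ V / x ]       = π₁
π₂ [ V / x ]       = π₂
recT [ V / x ]     = recT
zeroT [ V / x ]    = zeroT
sucT [ V / x ]     = sucT
(M ⊕ N) [ V / x ]  = (M [ V / x ]) ⊕ (N [ V / x ])

Dist : Set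
Dist = List (ℚ × Term)

pushforward : (Term → Term) → Dist → Dist
pushforward f = map (λ { (p , t) → (p , f t) })

-- The triple ⟨U,V,W⟩ is read as ⟨U,⟨V,W⟩⟩.
redex : Term → Term → Dist
redex (lam x M) V = (1ℚ , M [ V / x ]) ∷ []
redex π₁ (pair V W) = (1ℚ , V) ∷ []
redex π₂ (pair V W) = (1ℚ , W) ∷ []
redex recT (pair U (pair V zeroT)) = (1ℚ , U) ∷ []
redex recT (pair U (pair V (app sucT n))) =
  (1ℚ , app (app V n) (app recT (pair U (pair V n)))) ∷ []
redex _ _ = []

-- one step of weak call-by-value reduction; values reduce to
-- themselves (so that the lifting to distributions keeps them);
-- stuck terms (which do not arise from closed well-typed terms)
-- yield the empty subdistribution.
step  : Term → Dist
stepN : Term → Dist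
step t = if isVal t then (1ℚ , t) ∷ [] else stepN t

stepN (app M N) =
  if isVal N
  then (if isVal M then redex M N else pushforward (λ M' → app M' N) (step M))
  else pushforward (app M) (step N)
stepN (pair M N) =
  if isVal M then pushforward (pair M) (step N)
  else pushforward (λ M' → pair M' N) (step M)
stepN (M ⊕ N) = (½ , M) ∷ (½ , N) ∷ []
stepN _ = []

stepD : Dist → Dist
stepD = concatMap (λ { (p , t) → map (λ { (q , u) → (p * q , u) }) (step t) })

μ : Term → ℕ → Dist
μ M zero    = (1ℚ , M) ∷ []
μ M (suc k) = stepD (μ M k)

numVal : Term → Maybe ℕ
numVal zeroT         = just zero
numVal (app sucT t) with numVal t
... | just n  = just (suc n)
... | nothing = nothing
numVal _             = nothing

massNum : Dist → ℕ → ℚ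
massNum [] m = 0ℚ
massNum ((p , t) ∷ d) m with maybe-≡-dec _≟_ (numVal t) (just m)
... | yes _ = p + massNum d m
... | no  _ = massNum d m

-- Limits of the (monotone, bounded) sequences μ_k(V), without reals.
-- [[M]](V) = lim_k μ_k(V);  "lim ≥ q", "lim > 0", "lim = 1":

LimGe : (ℕ → ℚ) → ℚ → Set
LimGe s q = ∀ (ε : ℚ) → 0ℚ < ε → ∃[ k ] (q - ε ≤ s k)

LimPos : (ℕ → ℚ) → Set
LimPos s = ∃[ k ] (0ℚ < s k)

succMass : Term → (ℕ → ℕ) → ℕ → ℕ → ℚ
succMass M f n k = massNum (μ (app M (num n)) k) (suc (f n))

failMass : Term → ℕ → ℕ → ℚ
failMass M n k = massNum (μ (app M (num n)) k) zero

DT : (ℕ → ℕ) → Set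
DT f = ∃[ M ] (([] ⊢ M ∶ nat ⇒ nat) × (choiceFree M ≡ true) ×
         (∀ n → ∃[ k ] (μ (app M (num n)) k ≡ (1ℚ , num (f n)) ∷ [])))

-- M Las-Vegas-computes f: [[M n]] gives probability p_n to S f(n)
-- and 1 - p_n to 0, i.e. the two limits add up to 1.
LVcomputes : Term → (ℕ → ℕ) → Set
LVcomputes M f = ([] ⊢ M ∶ nat ⇒ nat) ×
  (∀ n → LimGe (λ k → succMass M f n k + failMass M n k) 1ℚ)

LV⊕ : (ℕ → ℕ) → Set
LV⊕ f = ∃[ M ] (LVcomputes M f × (∀ n → LimGe (succMass M f n) (+ 1 / 3)))

NDC⊕ : (ℕ → ℕ) → Set
NDC⊕ f = ∃[ M ] (LVcomputes M f × (∀ n → LimPos (succMass M f n)))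

recipℕ : (m : ℕ) → m ≢ 0 → ℚ
recipℕ m m≢0 = _/_ (+ 1) m {{ℕ.≢-nonZero m≢0}}

LVf⊕ : (ℕ → ℕ) → Set
LVf⊕ f = ∃[ h ] (DT h × Σ (∀ n → h n ≢ 0) λ h≢0 →
  ∃[ M ] (LVcomputes M f × (∀ n → LimGe (succMass M f n) (recipℕ (h n) (h≢0 n)))))

{-# OPTIONS --safe #-}
-- Translate T⊕ into System T by a call-by-value continuation-passing style with answer type nat,
-- a choice becoming the first nonzero one of its two answers.  A biorthogonal logical relation,
-- which only ever compares answers, shows that the translation of M n run with the identity
-- continuation yields 0 if all branches of M n end in 0, and the result of a nonzero branch
-- otherwise.  If M Las-Vegas-computes f with positive success probability, that nonzero result
-- can only be S f(n), since the masses of S f(n) and 0 add up to 1.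
module Submission where

open import Defs
open import Data.Nat as ℕ using (ℕ; zero; suc; _≟_)
import Data.Nat.Properties as ℕ
import Data.Integer as ℤ
open import Data.Rational using (ℚ; 0ℚ; 1ℚ; ½; _+_; _*_; _-_; -_; _≤_; _<_; _/_; positive; nonNegative)
open import Data.Rational.Properties
  using (+-identityˡ; +-identityʳ; +-assoc; +-mono-≤; +-monoˡ-≤; +-monoʳ-≤; +-monoʳ-<; +-monoˡ-<;
         *-identityʳ; *-distribˡ-+; neg-antimono-<; positive⁻¹; nonNegative⁻¹; pos*pos⇒pos;
         nonNeg*nonNeg⇒nonNeg; normalize-pos; _≤?_; ≤-refl; ≤-reflexive; ≤-trans; <⇒≤; <-irrefl;
         <-dense; module ≤-Reasoning)
open import Data.Rational.Solver using (module +-*-Solver)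
open import Data.Bool using (true; false; _∧_)
open import Data.Bool.Properties using (∧-zeroʳ)
open import Data.Maybe using (just)
open import Data.Maybe.Properties using (just-injective) renaming (≡-dec to maybe-≡-dec)
open import Data.List using ([]; _∷_; _++_; map)
open import Data.List.Properties using (map-cong; ++-identityʳ)
open import Data.List.Membership.Propositional using (_∈_)
open import Data.List.Membership.Propositional.Properties using (∈-++⁺ˡ; ∈-++⁺ʳ; ∈-map⁺)
open import Data.List.Relation.Unary.Any using (here; there)
open import Data.List.Relation.Unary.All using (All; []; _∷_)
open import Data.List.Relation.Unary.All.Properties using (++⁺)
open import Data.Product using (_×_; _,_; proj₁; proj₂; ∃-syntax; Σ-syntax)
open import Function using (_∘_; id; const)
open import Function.Bundles using (_⇔_; mk⇔)
open import Relation.Binary.Construct.Closure.ReflexiveTransitive using (Star; ε; _◅_; _◅◅_; gmap)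
open import Relation.Binary.PropositionalEquality hiding ([_])
open import Relation.Nullary.Decidable using (toWitness)
open import Relation.Nullary using (yes; no; contradiction)

-- Substitution of closed environments

-- When a choice is made at a higher type, nothing yet shows which branch will succeed; only the
-- final numeral tells. Continuations allow both branches to be run to the end at every type, so
-- that a choice needs nothing but a comparison of two numerals. Since failure is the numeral `0`, a
-- single number serves as the answer, in place of a list or tree of outcomes. No bound on the
-- number of choices is computed in advance: termination of all branches is part of what the logical
-- relation asserts, so no separate normalization proof is needed.

Closed : Term → Set
Closed M = ∀ x V → M [ V / x ] ≡ M

record ClosedVal (V : Term) : Set where
  constructor cv
  field
    value  : isVal V ≡ true
    closed : Closed V
open ClosedVal

Env : Set
Env = Var → Term

_[_↦_] : Env → Var → Term → Env
(γ [ x ↦ t ]) y with y ≟ x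
... | yes _ = t
... | no  _ = γ y

update-same : ∀ γ x t → (γ [ x ↦ t ]) x ≡ t
update-same γ x t with x ≟ x
... | yes _  = refl
... | no x≢x = contradiction refl x≢x

update-other : ∀ γ x t {y} → y ≢ x → (γ [ x ↦ t ]) y ≡ γ y
update-other γ x t {y} y≢x with y ≟ x
... | yes y≡x = contradiction y≡x y≢x
... | no _    = refl

sub : Env → Term → Term
sub γ (var x)    = γ x
sub γ (lam x M)  = lam x (sub (γ [ x ↦ var x ]) M)
sub γ (app M N)  = app (sub γ M) (sub γ N)
sub γ (pair M N) = pair (sub γ M) (sub γ N)
sub γ π₁         = π₁
sub γ π₂         = π₂
sub γ recT       = recT
sub γ zeroT      = zeroT
sub γ sucT       = sucT
sub γ (M ⊕ N)    = sub γ M ⊕ sub γ N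

update-cong : ∀ {γ δ} x t → (∀ z → z ≢ x → γ z ≡ δ z) → ∀ z → (γ [ x ↦ t ]) z ≡ (δ [ x ↦ t ]) z
update-cong x t eq z with z ≟ x
... | yes _  = refl
... | no z≢x = eq z z≢x

sub-cong : ∀ {γ δ} M → (∀ z → γ z ≡ δ z) → sub γ M ≡ sub δ M
sub-cong (var x)    eq = eq x
sub-cong (lam x M)  eq = cong (lam x) (sub-cong M (update-cong x (var x) (λ z _ → eq z)))
sub-cong (app M N)  eq = cong₂ app (sub-cong M eq) (sub-cong N eq)
sub-cong (pair M N) eq = cong₂ pair (sub-cong M eq) (sub-cong N eq)
sub-cong π₁         eq = refl
sub-cong π₂         eq = refl
sub-cong recT       eq = refl
sub-cong zeroT      eq = refl
sub-cong sucT       eq = refl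
sub-cong (M ⊕ N)    eq = cong₂ _⊕_ (sub-cong M eq) (sub-cong N eq)

-- One statement for two uses: `δ = γ` gives closedness, and `δ` sending `x` to `V` gives the
-- β-rule. The second hypothesis serves a binder equal to `x`, where `_[_/_]` stops and the
-- environments must already agree elsewhere.
sub-subst : ∀ {γ δ} M x V → (∀ z → γ z [ V / x ] ≡ δ z) → (∀ z → z ≢ x → γ z ≡ δ z) →
            sub γ M [ V / x ] ≡ sub δ M
sub-subst (var y) x V p q = p y
sub-subst {γ} {δ} (lam y M) x V p q with y ≟ x
... | yes refl = cong (lam x) (sub-cong M (update-cong x (var x) q))
... | no y≢x   = cong (lam y) (sub-subst M x V p′ q′)
  where
  p′ : ∀ z → (γ [ y ↦ var y ]) z [ V / x ] ≡ (δ [ y ↦ var y ]) z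
  p′ z with z ≟ y
  p′ z | no _  = p z
  p′ z | yes _ with y ≟ x
  ... | yes y≡x = contradiction y≡x y≢x
  ... | no _    = refl
  q′ : ∀ z → z ≢ x → (γ [ y ↦ var y ]) z ≡ (δ [ y ↦ var y ]) z
  q′ z z≢x with z ≟ y
  ... | yes _ = refl
  ... | no _  = q z z≢x
sub-subst (app M N)  x V p q = cong₂ app (sub-subst M x V p q) (sub-subst N x V p q)
sub-subst (pair M N) x V p q = cong₂ pair (sub-subst M x V p q) (sub-subst N x V p q)
sub-subst π₁         x V p q = refl
sub-subst π₂         x V p q = refl
sub-subst recT       x V p q = refl
sub-subst zeroT      x V p q = refl
sub-subst sucT       x V p q = refl
sub-subst (M ⊕ N)    x V p q = cong₂ _⊕_ (sub-subst M x V p q) (sub-subst N x V p q)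

-- Asked of every variable, also those outside any context, so that `sub γ M` is closed for each `M`
-- and free variables need no tracking.
AllClosed : Env → Set
AllClosed γ = ∀ x → Closed (γ x)

sub-closed : ∀ {γ} → AllClosed γ → ∀ M → Closed (sub γ M)
sub-closed c M x V = sub-subst M x V (λ z → c z x V) (λ _ _ → refl)

sub-lam-closedVal : ∀ {γ} → AllClosed γ → ∀ x M → ClosedVal (sub γ (lam x M))
sub-lam-closedVal c x M = cv refl (sub-closed c (lam x M))

update-closed : ∀ {γ} → AllClosed γ → ∀ x {V} → Closed V → AllClosed (γ [ x ↦ V ])
update-closed c x cV z with z ≟ x
... | yes _ = cV
... | no _  = c z

sub-β : ∀ {γ} → AllClosed γ → ∀ x M V → sub (γ [ x ↦ var x ]) M [ V / x ] ≡ sub (γ [ x ↦ V ]) M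
sub-β {γ} c x M V = sub-subst M x V p q
  where
  p : ∀ z → (γ [ x ↦ var x ]) z [ V / x ] ≡ (γ [ x ↦ V ]) z
  p z with z ≟ x
  p z | no _  = c z x V
  p z | yes _ with x ≟ x
  ... | yes _  = refl
  ... | no x≢x = contradiction refl x≢x
  q : ∀ z → z ≢ x → (γ [ x ↦ var x ]) z ≡ (γ [ x ↦ V ]) z
  q z z≢x = trans (update-other γ x (var x) z≢x) (sym (update-other γ x V z≢x))

sub-typed-id : ∀ {Γ M σ γ} → Γ ⊢ M ∶ σ → (∀ {x τ} → Γ ∋ x ∶ τ → γ x ≡ var x) → sub γ M ≡ M
sub-typed-id (⊢var x) h = h x
sub-typed-id {γ = γ} (⊢lam {Γ = Γ} {x = x} {σ = σ} M) h = cong (lam x) (sub-typed-id M h′)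
  where
  h′ : ∀ {y τ} → ((x , σ) ∷ Γ) ∋ y ∶ τ → (γ [ x ↦ var x ]) y ≡ var y
  h′ here = update-same γ x (var x)
  h′ (there y≢x y) = trans (update-other γ x (var x) y≢x) (h y)
sub-typed-id (⊢app M N)  h = cong₂ app (sub-typed-id M h) (sub-typed-id N h)
sub-typed-id (⊢pair M N) h = cong₂ pair (sub-typed-id M h) (sub-typed-id N h)
sub-typed-id ⊢π₁   h = refl
sub-typed-id ⊢π₂   h = refl
sub-typed-id ⊢rec  h = refl
sub-typed-id ⊢zero h = refl
sub-typed-id ⊢suc  h = refl
sub-typed-id (⊢⊕ M N) h = cong₂ _⊕_ (sub-typed-id M h) (sub-typed-id N h)

num-closed : ∀ n → Closed (num n)
num-closed zero    x V = refl
num-closed (suc n) x V = cong (app sucT) (num-closed n x V)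

num-value : ∀ n → isVal (num n) ≡ true
num-value zero    = refl
num-value (suc n) = num-value n

pair-closed : ∀ {M N} → Closed M → Closed N → Closed (pair M N)
pair-closed cM cN x V = cong₂ pair (cM x V) (cN x V)

num-closedVal : ∀ n → ClosedVal (num n)
num-closedVal n = cv (num-value n) (num-closed n)

pair-closedVal : ∀ {V W} → ClosedVal V → ClosedVal W → ClosedVal (pair V W)
pair-closedVal v w = cv (cong₂ _∧_ (value v) (value w)) (pair-closed (closed v) (closed w))

-- Reduction steps of non-values and evaluation contexts

record _⇝_ (M : Term) (d : Dist) : Set where
  constructor steps
  field
    nonvalue : isVal M ≡ false
    reduct   : stepN M ≡ d

_⟶_ : Term → Term → Set
M ⟶ N = M ⇝ ((1ℚ , N) ∷ [])

_⟶*_ : Term → Term → Set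
_⟶*_ = Star _⟶_



-- Evaluation contexts are given by the one property used of them rather than by a grammar, so that
-- they compose as functions.
record IsCtx (E : Term → Term) : Set where
  constructor ctx
  field
    plug : ∀ {M d} → M ⇝ d → E M ⇝ pushforward E d
open IsCtx

pushforward-∘ : ∀ (E F : Term → Term) d → pushforward E (pushforward F d) ≡ pushforward (E ∘ F) d
pushforward-∘ E F []      = refl
pushforward-∘ E F (_ ∷ d) = cong (_ ∷_) (pushforward-∘ E F d)

pushforward-id : ∀ d → d ≡ pushforward id d
pushforward-id []      = refl
pushforward-id (_ ∷ d) = cong (_ ∷_) (pushforward-id d)

ctx-∘ : ∀ {E F} → IsCtx E → IsCtx F → IsCtx (E ∘ F)
ctx-∘ {E} {F} cE cF .plug {M} {d} s = subst (E (F M) ⇝_) (pushforward-∘ E F d) (plug cE (plug cF s))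

ctx-id : IsCtx id
ctx-id .plug {M} {d} s = subst (M ⇝_) (pushforward-id d) s

app-nonvalue : ∀ M N → isVal M ∧ isVal N ≡ false → isVal (app M N) ≡ false
app-nonvalue (var _)    N h = refl
app-nonvalue (lam _ _)  N h = refl
app-nonvalue (app _ _)  N h = refl
app-nonvalue (pair _ _) N h = refl
app-nonvalue π₁         N h = refl
app-nonvalue π₂         N h = refl
app-nonvalue recT       N h = refl
app-nonvalue zeroT      N h = refl
app-nonvalue sucT       N h = h
app-nonvalue (_ ⊕ _)    N h = refl

-- The function part is arbitrary because arguments are evaluated first; for the same reason
-- `ctx-appˡ` needs a value as argument.
ctx-appʳ : ∀ M → IsCtx (app M)
ctx-appʳ M .plug {N} (steps n refl) = steps (app-nonvalue M N (trans (cong (isVal M ∧_) n) (∧-zeroʳ _))) eq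
  where
  eq : stepN (app M N) ≡ pushforward (app M) (stepN N)
  eq rewrite n = refl

ctx-appˡ : ∀ {V} → ClosedVal V → IsCtx (λ M → app M V)
ctx-appˡ {V} v .plug {M} (steps n refl) = steps (app-nonvalue M V (cong (_∧ isVal V) n)) eq
  where
  eq : stepN (app M V) ≡ pushforward (λ M → app M V) (stepN M)
  eq rewrite value v | n = refl

ctx-pairˡ : ∀ N → IsCtx (λ M → pair M N)
ctx-pairˡ N .plug {M} (steps n refl) = steps (cong (_∧ isVal N) n) eq
  where
  eq : stepN (pair M N) ≡ pushforward (λ M → pair M N) (stepN M)
  eq rewrite n = refl

ctx-pairʳ : ∀ {V} → ClosedVal V → IsCtx (pair V)
ctx-pairʳ {V} v .plug {M} (steps n refl) = steps (cong₂ _∧_ (value v) n) eq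
  where
  eq : stepN (pair V M) ≡ pushforward (pair V) (stepN M)
  eq rewrite value v | n = refl

plug* : ∀ {E} → IsCtx E → ∀ {M N} → M ⟶* N → E M ⟶* E N
plug* {E} c = gmap E (plug c)

⟶-β : ∀ {γ} → AllClosed γ → ∀ x M {V} → ClosedVal V →
      app (sub γ (lam x M)) V ⟶ sub (γ [ x ↦ V ]) M
⟶-β {γ} c x M {V} v = steps refl eq
  where
  eq : stepN (app (sub γ (lam x M)) V) ≡ (1ℚ , sub (γ [ x ↦ V ]) M) ∷ []
  eq rewrite value v = cong (λ t → (1ℚ , t) ∷ []) (sub-β c x M V)

⟶-π₁ : ∀ {V W} → ClosedVal V → ClosedVal W → app π₁ (pair V W) ⟶ V
⟶-π₁ {V} {W} v w = steps refl eq
  where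
  eq : stepN (app π₁ (pair V W)) ≡ (1ℚ , V) ∷ []
  eq rewrite value v | value w = refl

⟶-π₂ : ∀ {V W} → ClosedVal V → ClosedVal W → app π₂ (pair V W) ⟶ W
⟶-π₂ {V} {W} v w = steps refl eq
  where
  eq : stepN (app π₂ (pair V W)) ≡ (1ℚ , W) ∷ []
  eq rewrite value v | value w = refl

recN : Term → Term → ℕ → Term
recN U V n = app recT (pair U (pair V (num n)))

⟶-rec-zero : ∀ {U V} → ClosedVal U → ClosedVal V → recN U V 0 ⟶ U
⟶-rec-zero {U} {V} u v = steps refl eq
  where
  eq : stepN (recN U V 0) ≡ (1ℚ , U) ∷ []
  eq rewrite value u | value v = refl

⟶-rec-suc : ∀ {U V} n → ClosedVal U → ClosedVal V →
            recN U V (suc n) ⟶ app (app V (num n)) (recN U V n)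
⟶-rec-suc {U} {V} n u v = steps refl eq
  where
  eq : stepN (recN U V (suc n)) ≡ (1ℚ , app (app V (num n)) (recN U V n)) ∷ []
  eq rewrite value u | value v | num-value n = refl

-- Answers

_orElse_ : ℕ → ℕ → ℕ
zero  orElse b = b
suc a orElse b = suc a

infix 4 _⇓_ _~_

-- M ⇓ a: all branches of M end in numerals, the leftmost nonzero one being a (0 if there is none).
data _⇓_ : Term → ℕ → Set where
  done : ∀ n → num n ⇓ n
  one  : ∀ {M M′ a} → M ⟶ M′ → M′ ⇓ a → M ⇓ a
  two  : ∀ {M M₁ M₂ a b} → M ⇝ ((½ , M₁) ∷ (½ , M₂) ∷ []) → M₁ ⇓ a → M₂ ⇓ b → M ⇓ a orElse b

-- The left side is a source program, which may branch; the right side is a translated one, which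
-- runs deterministically.
_~_ : Term → Term → Set
M ~ N = ∃[ a ] (M ⇓ a × N ⟶* num a)

~-expandʳ : ∀ {M N N′} → N ⟶* N′ → M ~ N′ → M ~ N
~-expandʳ r (a , e , s) = a , e , r ◅◅ s

~-expandˡ : ∀ {M M′ N} → M ⟶ M′ → M′ ~ N → M ~ N
~-expandˡ r (a , e , s) = a , one r e , s

-- The biorthogonal closure of `R`: a computation is tested by an evaluation context in the source
-- and by a continuation value in the target. The test observes answers only, so the two branches of
-- a choice may yield unrelated values.
Comp : (Term → Term → Set) → Term → Term → Set
Comp R M N = ∀ E K → IsCtx E → ClosedVal K → (∀ V W → R V W → E V ~ app K W) → E M ~ app N K

Rel : Ty → Term → Term → Set
Rel nat     V W = ∃[ n ] (V ≡ num n × W ≡ num n)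
Rel (σ ⇒ τ) V W = ClosedVal V × ClosedVal W ×
  (∀ V₁ W₁ → Rel σ V₁ W₁ → Comp (Rel τ) (app V V₁) (app W W₁))
Rel (σ ⊗ τ) V W = ∃[ V₁ ] ∃[ V₂ ] ∃[ W₁ ] ∃[ W₂ ]
  (V ≡ pair V₁ V₂ × W ≡ pair W₁ W₂ × Rel σ V₁ W₁ × Rel τ V₂ W₂)

Rel-closedValˡ : ∀ σ {V W} → Rel σ V W → ClosedVal V
Rel-closedValˡ nat     (n , refl , _) = num-closedVal n
Rel-closedValˡ (σ ⇒ τ) (v , _)        = v
Rel-closedValˡ (σ ⊗ τ) (_ , _ , _ , _ , refl , _ , r , s) =
  pair-closedVal (Rel-closedValˡ σ r) (Rel-closedValˡ τ s)

Rel-closedValʳ : ∀ σ {V W} → Rel σ V W → ClosedVal W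
Rel-closedValʳ nat     (n , _ , refl) = num-closedVal n
Rel-closedValʳ (σ ⇒ τ) (_ , w , _)    = w
Rel-closedValʳ (σ ⊗ τ) (_ , _ , _ , _ , _ , refl , r , s) =
  pair-closedVal (Rel-closedValʳ σ r) (Rel-closedValʳ τ s)

Comp-expandʳ : ∀ {R M N N′} → N ⟶* N′ → Comp R M N′ → Comp R M N
Comp-expandʳ r c E K cE vK h = ~-expandʳ (plug* (ctx-appˡ vK) r) (c E K cE vK h)

Comp-expandˡ : ∀ {R M M′ N} → M ⟶ M′ → Comp R M′ N → Comp R M N
Comp-expandˡ r c E K cE vK h = ~-expandˡ (plug cE r) (c E K cE vK h)

-- The translation

-- The variables of the source term are renamed apart from the binders 0, …, 7 of the translation.
src : Var → Var
src x = 8 ℕ.+ x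

src-≢ : ∀ {x y} → x ≢ y → src x ≢ src y
src-≢ x≢y eq = x≢y (ℕ.+-cancelˡ-≡ 8 _ _ eq)

return : Term → Term
return t = lam 0 (app (var 0) t)

-- On S n the recursor returns S n, discarding the recursive value.
orElseT : Term → Term → Term
orElseT M N = app recT (pair N (pair (lam 1 (lam 2 (app sucT (var 1)))) M))

-- Variable 1 holds the triple ⟨U,⟨V,n⟩⟩; the recursion of the translation runs at type CPS σ, so
-- variables 4 and 5 are the predecessor and the computation obtained from it.
recStep : Term
recStep = lam 4 (lam 5 (lam 6 (app (var 5) (lam 7
  (app (app (app π₁ (app π₂ (var 1))) (var 4)) (lam 3 (app (app (var 3) (var 7)) (var 6))))))))

recBody : Term
recBody = app recT (pair (lam 3 (app (var 3) (app π₁ (var 1)))) (pair recStep (app π₂ (app π₂ (var 1)))))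

infix 50 _*
-- The evaluation order of the source is kept: argument before function, left component before
-- right. In `M ⊕ N` the continuation `var 0` is copied into both branches.
_* : Term → Term
var x *    = return (var (src x))
lam x M *  = return (lam (src x) (M *))
app M N *  = lam 0 (app (N *) (lam 1 (app (M *) (lam 2 (app (app (var 2) (var 1)) (var 0))))))
pair M N * = lam 0 (app (M *) (lam 1 (app (N *) (lam 2 (app (var 0) (pair (var 1) (var 2)))))))
π₁ *       = return (lam 1 (return (app π₁ (var 1))))
π₂ *       = return (lam 1 (return (app π₂ (var 1))))
recT *     = return (lam 1 recBody)
zeroT *    = return zeroT
sucT *     = return (lam 1 (return (app sucT (var 1))))
(M ⊕ N) *  = lam 0 (orElseT (app (M *) (var 0)) (app (N *) (var 0)))

-- Correctness of the translation

-- `W` may depend on `K`, since `return` places `T` under its own binder and `K` thus enters the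
-- environment of `T`. `T` need not be a value: a projection, for instance, is reduced before the
-- continuation receives it.
Comp-return : ∀ R T {V δ} → AllClosed δ →
  (∀ {K} → ClosedVal K → ∃[ W ] (R V W × sub (δ [ 0 ↦ K ]) T ⟶* W)) → Comp R V (sub δ (return T))
Comp-return R T c r E K cE vK h with r vK
... | W , rVW , s = ~-expandʳ (⟶-β c 0 (app (var 0) T) vK ◅ plug* (ctx-appʳ K) s) (h _ W rVW)

orElseT-num : ∀ {δ M N} a b → AllClosed δ → sub δ M ⟶* num a → sub δ N ⟶* num b →
              sub δ (orElseT M N) ⟶* num (a orElse b)
orElseT-num {δ} a b c r s =
  plug* (ctx-∘ (ctx-appʳ recT) (ctx-pairˡ _)) s ◅◅
  plug* (ctx-∘ (ctx-appʳ recT) (ctx-∘ (ctx-pairʳ (num-closedVal b)) (ctx-pairʳ vS))) r ◅◅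
  go a
  where
  S : Term
  S = sub δ (lam 1 (lam 2 (app sucT (var 1))))
  vS : ClosedVal S
  vS = sub-lam-closedVal c 1 (lam 2 (app sucT (var 1)))
  go : ∀ a → recN (num b) S a ⟶* num (a orElse b)
  go zero    = ⟶-rec-zero (num-closedVal b) vS ◅ ε
  go (suc a) = ⟶-rec-suc a (num-closedVal b) vS ◅
    (plug* (ctx-appʳ _) (go a) ◅◅
     plug (ctx-appˡ (num-closedVal (a orElse b))) (⟶-β c 1 (lam 2 (app sucT (var 1))) (num-closedVal a)) ◅
     ⟶-β (update-closed c 1 (num-closed a)) 2 (app sucT (var 1)) (num-closedVal (a orElse b)) ◅ ε)

π₁-Comp : ∀ σ τ {V W δ} → Rel (σ ⊗ τ) V W → AllClosed (δ [ 1 ↦ W ]) →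
          Comp (Rel σ) (app π₁ V) (sub (δ [ 1 ↦ W ]) (return (app π₁ (var 1))))
π₁-Comp σ τ (V₁ , V₂ , W₁ , W₂ , refl , refl , r₁ , r₂) c =
  Comp-expandˡ {Rel σ} (⟶-π₁ (Rel-closedValˡ σ r₁) (Rel-closedValˡ τ r₂))
    (Comp-return (Rel σ) (app π₁ (var 1)) c λ vK →
      W₁ , r₁ , ⟶-π₁ (Rel-closedValʳ σ r₁) (Rel-closedValʳ τ r₂) ◅ ε)

π₂-Comp : ∀ σ τ {V W δ} → Rel (σ ⊗ τ) V W → AllClosed (δ [ 1 ↦ W ]) →
          Comp (Rel τ) (app π₂ V) (sub (δ [ 1 ↦ W ]) (return (app π₂ (var 1))))
π₂-Comp σ τ (V₁ , V₂ , W₁ , W₂ , refl , refl , r₁ , r₂) c =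
  Comp-expandˡ {Rel τ} (⟶-π₂ (Rel-closedValˡ σ r₁) (Rel-closedValˡ τ r₂))
    (Comp-return (Rel τ) (app π₂ (var 1)) c λ vK →
      W₂ , r₂ , ⟶-π₂ (Rel-closedValʳ σ r₁) (Rel-closedValʳ τ r₂) ◅ ε)

module _ {σ U V n U′ V′ δ₀} (U~ : Rel σ U U′) (V~ : Rel (nat ⇒ σ ⇒ σ) V V′)
         (c : AllClosed (δ₀ [ 1 ↦ pair U′ (pair V′ (num n)) ])) where

  private
    δ   = δ₀ [ 1 ↦ pair U′ (pair V′ (num n)) ]
    vU  = Rel-closedValˡ σ U~
    vU′ = Rel-closedValʳ σ U~
    vV  = proj₁ V~
    vV′ = proj₁ (proj₂ V~)
    vn  = num-closedVal n

    U° V° body₃ body₆ body₇ : Term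
    U° = sub δ (lam 3 (app (var 3) (app π₁ (var 1))))
    V° = sub δ recStep
    body₃ = app (app (var 3) (var 7)) (var 6)
    body₇ = app (app (app π₁ (app π₂ (var 1))) (var 4)) (lam 3 body₃)
    body₆ = app (var 5) (lam 7 body₇)

    vU° : ClosedVal U°
    vU° = sub-lam-closedVal c 3 (app (var 3) (app π₁ (var 1)))
    vV° : ClosedVal V°
    vV° = sub-lam-closedVal c 4 (lam 5 (lam 6 body₆))

  -- A translated computation is a function waiting for its continuation. The target recursor
  -- therefore unrolls to a value `W` with all choices still pending; the source recursion is
  -- matched only once `W` meets a continuation.
  rec-iterate : ∀ m → ∃[ W ] (recN U° V° m ⟶* W × ClosedVal W × Comp (Rel σ) (recN U V m) W)
  rec-iterate zero = U° , ⟶-rec-zero vU° vV° ◅ ε , vU° , correct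
    where
    correct : Comp (Rel σ) (recN U V 0) U°
    correct E K cE vK h =
      ~-expandˡ (plug cE (⟶-rec-zero vU vV))
        (~-expandʳ (⟶-β c 3 (app (var 3) (app π₁ (var 1))) vK ◅
                    plug (ctx-appʳ K) (⟶-π₁ vU′ (pair-closedVal vV′ vn)) ◅ ε)
          (h U U′ U~))
  rec-iterate (suc m) with rec-iterate m
  ... | Wₘ , r , vWₘ , ih = sub δ₂ (lam 6 body₆) ,
      (⟶-rec-suc m vU° vV° ◅
        (plug* (ctx-appʳ (app V° (num m))) r ◅◅
         plug (ctx-appˡ vWₘ) (⟶-β c 4 (lam 5 (lam 6 body₆)) (num-closedVal m)) ◅
         ⟶-β c₁ 5 (lam 6 body₆) vWₘ ◅ ε)) ,
      sub-lam-closedVal c₂ 6 body₆ , correct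
    where
    δ₂ : Env
    δ₂ = (δ [ 4 ↦ num m ]) [ 5 ↦ Wₘ ]
    c₁ = update-closed c 4 (num-closed m)
    c₂ : AllClosed δ₂
    c₂ = update-closed c₁ 5 (closed vWₘ)
    correct : Comp (Rel σ) (recN U V (suc m)) (sub δ₂ (lam 6 body₆))
    correct E K cE vK h =
      ~-expandˡ (plug cE (⟶-rec-suc m vU vV))
        (~-expandʳ (⟶-β c₂ 6 body₆ vK ◅ ε)
          -- The recursive call is the argument of `V m` and runs first, so the induction hypothesis
          -- is used in the context that waits for this argument; `V m` is run in `after-rec`.
          (ih (E ∘ app (app V (num m))) _ (ctx-∘ cE (ctx-appʳ _)) (sub-lam-closedVal c₃ 7 body₇) after-rec))
      where
      c₃ : AllClosed (δ₂ [ 6 ↦ K ])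
      c₃ = update-closed c₂ 6 (closed vK)
      after-rec : ∀ X Y → Rel σ X Y → E (app (app V (num m)) X) ~ app (sub (δ₂ [ 6 ↦ K ]) (lam 7 body₇)) Y
      after-rec X Y X~Y =
        ~-expandʳ (⟶-β c₃ 7 body₇ vY ◅
                   plug* (ctx-∘ (ctx-appˡ vK₃) (ctx-appˡ (num-closedVal m)))
                     (plug (ctx-appʳ π₁) (⟶-π₂ vU′ (pair-closedVal vV′ vn)) ◅ ⟶-π₁ vV′ vn ◅ ε))
          (proj₂ (proj₂ V~) _ _ (m , refl , refl) (λ M → E (app M X)) K₃
            (ctx-∘ cE (ctx-appˡ (Rel-closedValˡ σ X~Y))) vK₃
            λ G G′ G~ → ~-expandʳ (⟶-β c₄ 3 body₃ (proj₁ (proj₂ G~)) ◅ ε)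
              (proj₂ (proj₂ G~) X Y X~Y E K cE vK h))
        where
        vY = Rel-closedValʳ σ X~Y
        c₄ : AllClosed ((δ₂ [ 6 ↦ K ]) [ 7 ↦ Y ])
        c₄ = update-closed c₃ 7 (closed vY)
        K₃ : Term
        K₃ = sub ((δ₂ [ 6 ↦ K ]) [ 7 ↦ Y ]) (lam 3 body₃)
        vK₃ : ClosedVal K₃
        vK₃ = sub-lam-closedVal c₄ 3 body₃

  rec-Comp : Comp (Rel σ) (recN U V n) (sub δ recBody)
  rec-Comp with rec-iterate n
  ... | W , r , _ , correct = Comp-expandʳ {Rel σ} (reach ◅◅ r) correct
    where
    reach : sub δ recBody ⟶* recN U° V° n
    reach = plug* (ctx-∘ (ctx-appʳ recT) (ctx-∘ (ctx-pairʳ vU°) (ctx-pairʳ vV°)))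
      (plug (ctx-appʳ π₂) (⟶-π₂ vU′ (pair-closedVal vV′ vn)) ◅ ⟶-π₂ vV′ vn ◅ ε)

-- `src x` computes to eight successors, so looking it up after an update at one of the binders 0 to
-- 7 reduces to the old value. Hence a proof of `RelEnv` is reused unchanged under the binders of
-- the translation.
RelEnv : Ctx → Env → Env → Set
RelEnv Γ γ δ = ∀ {x τ} → Γ ∋ x ∶ τ → Rel τ (γ x) (δ (src x))

RelEnv-extend : ∀ {Γ γ δ x σ V W} → RelEnv Γ γ δ → Rel σ V W →
  RelEnv ((x , σ) ∷ Γ) (γ [ x ↦ V ]) (δ [ src x ↦ W ])
RelEnv-extend {γ = γ} {δ} {x} {σ} {V} {W} ρ r here =
  subst₂ (Rel σ) (sym (update-same γ x V)) (sym (update-same δ (src x) W)) r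
RelEnv-extend {γ = γ} {δ} {x} {σ} {V} {W} ρ r (there {σ = τ} y≢x y) =
  subst₂ (Rel τ) (sym (update-other γ x V y≢x)) (sym (update-other δ (src x) W (src-≢ y≢x))) (ρ y)

-- The fundamental lemma of the relation. Each clause hands its premises the source context and the
-- target continuation in force when that subterm is evaluated.
translation-correct : ∀ {Γ M σ} → Γ ⊢ M ∶ σ → ∀ {γ δ} → AllClosed γ → AllClosed δ → RelEnv Γ γ δ →
  Comp (Rel σ) (sub γ M) (sub δ (M *))
translation-correct (⊢var {σ = σ} x) cγ cδ ρ = Comp-return (Rel σ) (var (src _)) cδ λ vK → _ , ρ x , ε
translation-correct (⊢lam {x = x} {M} {σ} {τ} ⊢M) {γ} {δ} cγ cδ ρ =
  Comp-return (Rel (σ ⇒ τ)) (lam (src x) (M *)) cδ λ {K} vK →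
    let c′ = update-closed cδ 0 (closed vK) in
    _ , (sub-lam-closedVal cγ x M , sub-lam-closedVal c′ (src x) (M *) ,
      λ V W r → let vV = Rel-closedValˡ σ r ; vW = Rel-closedValʳ σ r in
        Comp-expandˡ {Rel τ} (⟶-β cγ x M vV)
          (Comp-expandʳ {Rel τ} (⟶-β c′ (src x) (M *) vW ◅ ε)
            (translation-correct ⊢M (update-closed cγ x (closed vV)) (update-closed c′ (src x) (closed vW))
              (RelEnv-extend {δ = δ [ 0 ↦ K ]} ρ r)))) , ε
translation-correct (⊢app {M = M} {N} {σ} {τ} ⊢M ⊢N) {γ} {δ} cγ cδ ρ E K cE vK h =
  ~-expandʳ (⟶-β cδ 0 (app (N *) (lam 1 body₁)) vK ◅ ε)
    (translation-correct ⊢N cγ c₀ ρ (E ∘ app (sub γ M)) _ (ctx-∘ cE (ctx-appʳ _)) (sub-lam-closedVal c₀ 1 body₁)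
      λ V W r → let vV = Rel-closedValˡ σ r ; vW = Rel-closedValʳ σ r ; c₁ = update-closed c₀ 1 (closed vW) in
        ~-expandʳ (⟶-β c₀ 1 body₁ vW ◅ ε)
          (translation-correct ⊢M cγ c₁ ρ (λ t → E (app t V)) _
            (ctx-∘ cE (ctx-appˡ vV)) (sub-lam-closedVal c₁ 2 body₂)
            λ G G′ r′ → ~-expandʳ (⟶-β c₁ 2 body₂ (proj₁ (proj₂ r′)) ◅ ε)
              (proj₂ (proj₂ r′) V W r E K cE vK h)))
  where
  body₂ = app (app (var 2) (var 1)) (var 0)
  body₁ = app (M *) (lam 2 body₂)
  c₀ = update-closed cδ 0 (closed vK)
translation-correct (⊢pair {M = M} {N} {σ} {τ} ⊢M ⊢N) {γ} {δ} cγ cδ ρ E K cE vK h =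
  ~-expandʳ (⟶-β cδ 0 (app (M *) (lam 1 body₁)) vK ◅ ε)
    (translation-correct ⊢M cγ c₀ ρ (λ t → E (pair t (sub γ N))) _
      (ctx-∘ cE (ctx-pairˡ _)) (sub-lam-closedVal c₀ 1 body₁)
      λ V₁ W₁ r₁ → let vV = Rel-closedValˡ σ r₁ ; vW = Rel-closedValʳ σ r₁ ; c₁ = update-closed c₀ 1 (closed vW) in
        ~-expandʳ (⟶-β c₀ 1 body₁ vW ◅ ε)
          (translation-correct ⊢N cγ c₁ ρ (E ∘ pair V₁) _
            (ctx-∘ cE (ctx-pairʳ vV)) (sub-lam-closedVal c₁ 2 body₂)
            λ V₂ W₂ r₂ → ~-expandʳ (⟶-β c₁ 2 body₂ (Rel-closedValʳ τ r₂) ◅ ε)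
              (h _ _ (_ , _ , _ , _ , refl , refl , r₁ , r₂))))
  where
  body₂ = app (var 0) (pair (var 1) (var 2))
  body₁ = app (N *) (lam 2 body₂)
  c₀ = update-closed cδ 0 (closed vK)
translation-correct (⊢π₁ {σ = σ} {τ}) cγ cδ ρ = Comp-return (Rel (σ ⊗ τ ⇒ σ)) (lam 1 (return (app π₁ (var 1)))) cδ
  λ vK →
  let c₀ = update-closed cδ 0 (closed vK) in
  _ , (cv refl (λ _ _ → refl) , sub-lam-closedVal c₀ 1 (return (app π₁ (var 1))) , λ V W r →
    let vW = Rel-closedValʳ (σ ⊗ τ) r in
    Comp-expandʳ {Rel σ} (⟶-β c₀ 1 (return (app π₁ (var 1))) vW ◅ ε)
      (π₁-Comp σ τ r (update-closed c₀ 1 (closed vW)))) , ε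
translation-correct (⊢π₂ {σ = σ} {τ}) cγ cδ ρ = Comp-return (Rel (σ ⊗ τ ⇒ τ)) (lam 1 (return (app π₂ (var 1)))) cδ
  λ vK →
  let c₀ = update-closed cδ 0 (closed vK) in
  _ , (cv refl (λ _ _ → refl) , sub-lam-closedVal c₀ 1 (return (app π₂ (var 1))) , λ V W r →
    let vW = Rel-closedValʳ (σ ⊗ τ) r in
    Comp-expandʳ {Rel τ} (⟶-β c₀ 1 (return (app π₂ (var 1))) vW ◅ ε)
      (π₂-Comp σ τ r (update-closed c₀ 1 (closed vW)))) , ε
translation-correct (⊢rec {σ = σ}) cγ cδ ρ = Comp-return (Rel (σ ⊗ (nat ⇒ σ ⇒ σ) ⊗ nat ⇒ σ)) (lam 1 recBody) cδ
  λ vK →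
  let c₀ = update-closed cδ 0 (closed vK) in
  _ , (cv refl (λ _ _ → refl) , sub-lam-closedVal c₀ 1 recBody ,
    λ { V W r@(_ , _ , _ , _ , refl , refl , rU , (_ , _ , _ , _ , refl , refl , rV , (n , refl , refl))) →
      let vW = Rel-closedValʳ (σ ⊗ (nat ⇒ σ ⇒ σ) ⊗ nat) r in
      Comp-expandʳ {Rel σ} (⟶-β c₀ 1 recBody vW ◅ ε)
        (rec-Comp rU rV (update-closed c₀ 1 (closed vW))) }) , ε
translation-correct ⊢zero cγ cδ ρ = Comp-return (Rel nat) zeroT cδ λ vK → _ , (0 , refl , refl) , ε
translation-correct ⊢suc cγ cδ ρ = Comp-return (Rel (nat ⇒ nat)) (lam 1 (return (app sucT (var 1)))) cδ
  λ vK →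
  let c₀ = update-closed cδ 0 (closed vK) in
  _ , (cv refl (λ _ _ → refl) , sub-lam-closedVal c₀ 1 (return (app sucT (var 1))) , λ { V W (n , refl , refl) →
    Comp-expandʳ {Rel nat} (⟶-β c₀ 1 (return (app sucT (var 1))) (num-closedVal n) ◅ ε)
      (Comp-return (Rel nat) (app sucT (var 1)) (update-closed c₀ 1 (num-closed n))
        λ vK′ → _ , (suc n , refl , refl) , ε) }) , ε
-- Both branches are tested with the same `E` and `K`; the two answers obtained are then combined by
-- `orElse` on either side, whatever the type of the choice.
translation-correct (⊢⊕ {M = M} {N} ⊢M ⊢N) {γ} {δ} cγ cδ ρ E K cE vK h
  with translation-correct ⊢M cγ (update-closed cδ 0 (closed vK)) ρ E K cE vK h
     | translation-correct ⊢N cγ (update-closed cδ 0 (closed vK)) ρ E K cE vK h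
... | a , e₁ , r₁ | b , e₂ , r₂ =
  a orElse b , two (plug cE (steps refl refl)) e₁ e₂ ,
  ⟶-β cδ 0 (orElseT (app (M *) (var 0)) (app (N *) (var 0))) vK ◅
    orElseT-num {δ [ 0 ↦ K ]} {app (M *) (var 0)} {app (N *) (var 0)} a b (update-closed cδ 0 (closed vK)) r₁ r₂

-- Typing and choice-freeness of the translation

⟦_⟧ : Ty → Ty
CPS : Ty → Ty
⟦ nat ⟧   = nat
⟦ σ ⇒ τ ⟧ = ⟦ σ ⟧ ⇒ CPS τ
⟦ σ ⊗ τ ⟧ = ⟦ σ ⟧ ⊗ ⟦ τ ⟧
CPS σ = (⟦ σ ⟧ ⇒ nat) ⇒ nat

pattern ⊢v₀ = ⊢var here
pattern ⊢v₁ p = ⊢var (there p here)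
pattern ⊢v₂ p q = ⊢var (there p (there q here))

⊢return : ∀ {Δ t σ} → ((0 , ⟦ σ ⟧ ⇒ nat) ∷ Δ) ⊢ t ∶ ⟦ σ ⟧ → Δ ⊢ return t ∶ CPS σ
⊢return t = ⊢lam (⊢app ⊢v₀ t)

⊢recBody : ∀ {Δ} σ → ((1 , ⟦ σ ⊗ (nat ⇒ σ ⇒ σ) ⊗ nat ⟧) ∷ Δ) ⊢ recBody ∶ CPS σ
⊢recBody σ = ⊢app ⊢rec (⊢pair
  (⊢lam (⊢app ⊢v₀ (⊢app ⊢π₁ (⊢v₁ λ ()))))
  (⊢pair
    (⊢lam (⊢lam (⊢lam (⊢app (⊢v₁ λ ()) (⊢lam (⊢app
      (⊢app (⊢app ⊢π₁ (⊢app ⊢π₂ (⊢var (there (λ ()) (there (λ ()) (there (λ ()) (there (λ ()) here)))))))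
            (⊢var (there (λ ()) (there (λ ()) (there (λ ()) here)))))
      (⊢lam (⊢app (⊢app ⊢v₀ (⊢v₁ λ ())) (⊢v₂ (λ ()) λ ())))))))))
    (⊢app ⊢π₂ (⊢app ⊢π₂ ⊢v₀))))

SrcVars : Ctx → Ctx → Set
SrcVars Γ Δ = ∀ {x τ} → Γ ∋ x ∶ τ → Δ ∋ src x ∶ ⟦ τ ⟧

SrcVars-extend : ∀ {Γ Δ x σ} → SrcVars Γ Δ → SrcVars ((x , σ) ∷ Γ) ((src x , ⟦ σ ⟧) ∷ Δ)
SrcVars-extend w here          = here
SrcVars-extend w (there y≢x y) = there (src-≢ y≢x) (w y)

translation-typed : ∀ {Γ M σ} → Γ ⊢ M ∶ σ → ∀ {Δ} → SrcVars Γ Δ → Δ ⊢ M * ∶ CPS σ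
translation-typed (⊢var {σ = σ} x) w = ⊢return {σ = σ} (⊢var (there (λ ()) (w x)))
translation-typed (⊢lam {σ = σ} {τ} M) w = ⊢return {σ = σ ⇒ τ} (⊢lam
  (translation-typed M (SrcVars-extend λ x → there (λ ()) (w x))))
translation-typed (⊢app M N) w = ⊢lam (⊢app
  (translation-typed N λ x → there (λ ()) (w x))
  (⊢lam (⊢app (translation-typed M λ x → there (λ ()) (there (λ ()) (w x)))
    (⊢lam (⊢app (⊢app ⊢v₀ (⊢v₁ λ ())) (⊢v₂ (λ ()) λ ()))))))
translation-typed (⊢pair M N) w = ⊢lam (⊢app
  (translation-typed M λ x → there (λ ()) (w x))
  (⊢lam (⊢app (translation-typed N λ x → there (λ ()) (there (λ ()) (w x)))
    (⊢lam (⊢app (⊢v₂ (λ ()) λ ()) (⊢pair (⊢v₁ λ ()) ⊢v₀))))))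
translation-typed (⊢π₁ {σ = σ} {τ}) w =
  ⊢return {σ = σ ⊗ τ ⇒ σ} (⊢lam (⊢return {σ = σ} (⊢app ⊢π₁ (⊢v₁ λ ()))))
translation-typed (⊢π₂ {σ = σ} {τ}) w =
  ⊢return {σ = σ ⊗ τ ⇒ τ} (⊢lam (⊢return {σ = τ} (⊢app ⊢π₂ (⊢v₁ λ ()))))
translation-typed (⊢rec {σ = σ}) w =
  ⊢return {σ = σ ⊗ (nat ⇒ σ ⇒ σ) ⊗ nat ⇒ σ} (⊢lam (⊢recBody σ))
translation-typed ⊢zero w = ⊢return {σ = nat} ⊢zero
translation-typed ⊢suc  w = ⊢return {σ = nat ⇒ nat} (⊢lam (⊢return {σ = nat} (⊢app ⊢suc (⊢v₁ λ ()))))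
translation-typed (⊢⊕ M N) w = ⊢lam (⊢app ⊢rec (⊢pair
  (⊢app (translation-typed N λ x → there (λ ()) (w x)) ⊢v₀)
  (⊢pair (⊢lam (⊢lam (⊢app ⊢suc (⊢v₁ λ ()))))
    (⊢app (translation-typed M λ x → there (λ ()) (w x)) ⊢v₀))))

translation-choiceFree : ∀ M → choiceFree (M *) ≡ true
translation-choiceFree (var x)    = refl
translation-choiceFree (lam x M)  = translation-choiceFree M
translation-choiceFree (app M N)  rewrite translation-choiceFree M | translation-choiceFree N = refl
translation-choiceFree (pair M N) rewrite translation-choiceFree M | translation-choiceFree N = refl
translation-choiceFree π₁         = refl
translation-choiceFree π₂         = refl
translation-choiceFree recT       = refl
translation-choiceFree zeroT      = refl
translation-choiceFree sucT       = refl
translation-choiceFree (M ⊕ N)    rewrite translation-choiceFree M | translation-choiceFree N = refl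

-- Extraction of the answer

-- `zeroT` is a mere filler, as environments are total; a term typed in the empty context is not
-- affected by it (`sub-id`).
closedEnv : Env
closedEnv = const zeroT

closedEnv-closed : AllClosed closedEnv
closedEnv-closed _ _ _ = refl

sub-id : ∀ {M σ} γ → [] ⊢ M ∶ σ → sub γ M ≡ M
sub-id γ ⊢M = sub-typed-id ⊢M λ ()

⟶-β-closed : ∀ {x M σ V} → [] ⊢ lam x M ∶ σ → ClosedVal V → app (lam x M) V ⟶ sub (closedEnv [ x ↦ V ]) M
⟶-β-closed {x} {M} {V = V} ⊢M v =
  subst (λ t → app t V ⟶ sub (closedEnv [ x ↦ V ]) M) (sub-id closedEnv ⊢M) (⟶-β closedEnv-closed x M v)

predT : Term → Term
predT t = app recT (pair zeroT (pair (lam 1 (lam 2 (var 1))) t))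

predT-num : ∀ {M} a → M ⟶* num a → predT M ⟶* num (ℕ.pred a)
predT-num {M} a r = plug* (ctx-∘ (ctx-appʳ recT) (ctx-∘ (ctx-pairʳ (num-closedVal 0)) (ctx-pairʳ vP))) r ◅◅ go a
  where
  P : Term
  P = lam 1 (lam 2 (var 1))
  vP : ClosedVal P
  vP = sub-lam-closedVal closedEnv-closed 1 (lam 2 (var 1))
  go : ∀ a → recN zeroT P a ⟶* num (ℕ.pred a)
  go zero    = ⟶-rec-zero (num-closedVal 0) vP ◅ ε
  go (suc a) = ⟶-rec-suc a (num-closedVal 0) vP ◅
    (plug* (ctx-appʳ _) (go a) ◅◅
     plug (ctx-appˡ (num-closedVal (ℕ.pred a))) (⟶-β closedEnv-closed 1 (lam 2 (var 1)) (num-closedVal a)) ◅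
     ⟶-β (update-closed closedEnv-closed 1 (num-closed a)) 2 (var 1) (num-closedVal (ℕ.pred a)) ◅ ε)

-- The outer continuation applies the function that `M` yields to the input, the inner one is the
-- identity. The predecessor strips the successor marking a success; an answer 0 would go to 0, a
-- case excluded by `lv-answer`.
extract : Term → Term
extract M = lam 0 (predT (app (M *) (lam 1 (app (app (var 1) (var 0)) (lam 2 (var 2))))))

extract-typed : ∀ {M} → [] ⊢ M ∶ nat ⇒ nat → [] ⊢ extract M ∶ nat ⇒ nat
extract-typed ⊢M = ⊢lam (⊢app ⊢rec (⊢pair ⊢zero (⊢pair (⊢lam (⊢lam (⊢v₁ λ ())))
  (⊢app (translation-typed ⊢M λ ()) (⊢lam (⊢app (⊢app ⊢v₀ (⊢v₁ λ ())) (⊢lam ⊢v₀)))))))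

extract-choiceFree : ∀ M → choiceFree (extract M) ≡ true
extract-choiceFree M rewrite translation-choiceFree M = refl

extract-correct : ∀ {M} → [] ⊢ M ∶ nat ⇒ nat → ∀ n →
  ∃[ a ] (app M (num n) ⇓ a × app (extract M) (num n) ⟶* num (ℕ.pred a))
extract-correct {M} ⊢M n =
  let a , e , r = run in
  a , subst (λ t → app t (num n) ⇓ a) (sub-id closedEnv ⊢M) e ,
  ⟶-β-closed (extract-typed ⊢M) (num-closedVal n) ◅ predT-num a r
  where
  δ : Env
  δ = closedEnv [ 0 ↦ num n ]
  c : AllClosed δ
  c = update-closed closedEnv-closed 0 (num-closed n)
  body : Term
  body = app (app (var 1) (var 0)) (lam 2 (var 2))
  run : app (sub closedEnv M) (num n) ~ app (sub δ (M *)) (sub δ (lam 1 body))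
  run = translation-correct ⊢M closedEnv-closed c (λ ()) (λ t → app t (num n)) _
    (ctx-appˡ (num-closedVal n)) (sub-lam-closedVal c 1 body) λ F G (_ , vG , F~G) →
      ~-expandʳ (⟶-β c 1 body vG ◅ ε)
        (F~G (num n) (num n) (n , refl , refl) id (lam 2 (var 2)) ctx-id
          (sub-lam-closedVal closedEnv-closed 2 (var 2))
          λ { _ _ (m , refl , refl) → m , done m , ⟶-β closedEnv-closed 2 (var 2) (num-closedVal m) ◅ ε })

-- Distributions

scale : ℚ → Dist → Dist
scale p = map λ e → p * proj₁ e , proj₂ e

stepD-∷ : ∀ p t d → stepD ((p , t) ∷ d) ≡ scale p (step t) ++ stepD d
stepD-∷ p t d = cong (_++ stepD d) (map-cong (λ _ → refl) (step t))

step-nonvalue : ∀ {M d} → M ⇝ d → step M ≡ d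
step-nonvalue (steps n refl) rewrite n = refl

step-num : ∀ n → step (num n) ≡ (1ℚ , num n) ∷ []
step-num n rewrite num-value n = refl

-- A view of `step t` for terminating `t` that treats resting numerals and reducible terms alike;
-- the later invariants are checked on its three cases.
data Unfold (t : Term) : ℕ → Dist → Set where
  stay  : ∀ a → t ≡ num a → Unfold t a ((1ℚ , t) ∷ [])
  move  : ∀ {t′ a} → t′ ⇓ a → Unfold t a ((1ℚ , t′) ∷ [])
  split : ∀ {t₁ t₂ a b} → t₁ ⇓ a → t₂ ⇓ b → Unfold t (a orElse b) ((½ , t₁) ∷ (½ , t₂) ∷ [])

unfold : ∀ {t a} → t ⇓ a → Unfold t a (step t)
unfold (done n)      = subst (Unfold _ _) (sym (step-num n)) (stay n refl)
unfold (one s e)     = subst (Unfold _ _) (sym (step-nonvalue s)) (move e)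
unfold (two s e₁ e₂) = subst (Unfold _ _) (sym (step-nonvalue s)) (split e₁ e₂)

total : Dist → ℚ
total []            = 0ℚ
total ((p , _) ∷ d) = p + total d

total-++ : ∀ d e → total (d ++ e) ≡ total d + total e
total-++ []            e = sym (+-identityˡ (total e))
total-++ ((p , _) ∷ d) e = trans (cong (p +_) (total-++ d e)) (sym (+-assoc p (total d) (total e)))

halves : ∀ p → p * ½ + p * ½ ≡ p
halves p = trans (sym (*-distribˡ-+ p ½ ½)) (*-identityʳ p)

total-step : ∀ p {t a d} → Unfold t a d → total (scale p d) ≡ p
total-step p (stay _ _)  = trans (+-identityʳ (p * 1ℚ)) (*-identityʳ p)
total-step p (move _)    = trans (+-identityʳ (p * 1ℚ)) (*-identityʳ p)
total-step p (split _ _) = trans (cong (λ x → p * ½ + x) (+-identityʳ (p * ½))) (halves p)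

Terminating : ℚ × Term → Set
Terminating (p , t) = 0ℚ ≤ p × ∃[ a ] t ⇓ a

0≤* : ∀ {p q} → 0ℚ ≤ p → 0ℚ ≤ q → 0ℚ ≤ p * q
0≤* {p} {q} hp hq = nonNegative⁻¹ (p * q) {{nonNeg*nonNeg⇒nonNeg p {{nonNegative hp}} q {{nonNegative hq}}}}

0<* : ∀ {p q} → 0ℚ < p → 0ℚ < q → 0ℚ < p * q
0<* {p} {q} hp hq = positive⁻¹ (p * q) {{pos*pos⇒pos p {{positive hp}} q {{positive hq}}}}

0<1 : 0ℚ < 1ℚ
0<1 = positive⁻¹ 1ℚ

0<½ : 0ℚ < ½
0<½ = positive⁻¹ ½

step-terminating : ∀ {p t a d} → 0ℚ ≤ p → Unfold t a d → All Terminating (scale p d)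
step-terminating h (stay a refl)  = (0≤* h (<⇒≤ 0<1) , a , done a) ∷ []
step-terminating h (move e)       = (0≤* h (<⇒≤ 0<1) , _ , e) ∷ []
step-terminating h (split e₁ e₂)  = (0≤* h (<⇒≤ 0<½) , _ , e₁) ∷ (0≤* h (<⇒≤ 0<½) , _ , e₂) ∷ []

stepD-terminating : ∀ {d} → All Terminating d → All Terminating (stepD d)
stepD-terminating [] = []
stepD-terminating {(p , t) ∷ d} ((h , _ , e) ∷ g) =
  subst (All Terminating) (sym (stepD-∷ p t d)) (++⁺ (step-terminating h (unfold e)) (stepD-terminating g))

stepD-total : ∀ {d} → All Terminating d → total (stepD d) ≡ total d
stepD-total [] = refl
stepD-total {(p , t) ∷ d} ((_ , _ , e) ∷ g) = begin
  total (stepD ((p , t) ∷ d))                   ≡⟨ cong total (stepD-∷ p t d) ⟩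
  total (scale p (step t) ++ stepD d)           ≡⟨ total-++ (scale p (step t)) (stepD d) ⟩
  total (scale p (step t)) + total (stepD d)    ≡⟨ cong₂ _+_ (total-step p (unfold e)) (stepD-total g) ⟩
  p + total d                                   ∎
  where open ≡-Reasoning

μ-terminating : ∀ {M a} → M ⇓ a → ∀ k → All Terminating (μ M k)
μ-terminating e zero    = (<⇒≤ 0<1 , _ , e) ∷ []
μ-terminating e (suc k) = stepD-terminating (μ-terminating e k)

μ-total : ∀ {M a} → M ⇓ a → ∀ k → total (μ M k) ≡ 1ℚ
μ-total e zero    = refl
μ-total e (suc k) = trans (stepD-total (μ-terminating e k)) (μ-total e k)

-- Masses of numerals along the reduction

numVal-num : ∀ n → numVal (num n) ≡ just n
numVal-num zero    = refl
numVal-num (suc n) rewrite numVal-num n = refl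

numVal⇒num : ∀ t {m} → numVal t ≡ just m → t ≡ num m
numVal⇒num zeroT refl = refl
numVal⇒num (app sucT t) eq with numVal t in h
numVal⇒num (app sucT t) refl | just n = cong (app sucT) (numVal⇒num t h)

num-injective : ∀ {m n} → num m ≡ num n → m ≡ n
num-injective {m} {n} eq = just-injective (trans (sym (numVal-num m)) (trans (cong numVal eq) (numVal-num n)))

⇓-num : ∀ {t a m} → t ⇓ a → t ≡ num m → a ≡ m
⇓-num         (done n)            eq   = num-injective eq
⇓-num {m = m} (one (steps n _) _)   refl = contradiction (trans (sym n) (num-value m)) λ ()
⇓-num {m = m} (two (steps n _) _ _) refl = contradiction (trans (sym n) (num-value m)) λ ()

massNum-++-≤ : ∀ {d} e m → All Terminating e → massNum d m ≤ massNum (e ++ d) m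
massNum-++-≤ []            m []            = ≤-refl
massNum-++-≤ ((p , t) ∷ e) m ((h , _) ∷ g) with maybe-≡-dec _≟_ (numVal t) (just m)
... | yes _ = ≤-trans (massNum-++-≤ e m g) (≤-trans (≤-reflexive (sym (+-identityˡ _))) (+-monoˡ-≤ _ h))
... | no _  = massNum-++-≤ e m g

massNum-hit : ∀ p m d → massNum ((p , num m) ∷ d) m ≡ p + massNum d m
massNum-hit p m d with maybe-≡-dec _≟_ (numVal (num m)) (just m)
... | yes _ = refl
... | no h  = contradiction (numVal-num m) h

-- Numerals step to themselves with full weight, and all other entries contribute nonnegative
-- weights.
massNum-stepD : ∀ {d} m → All Terminating d → massNum d m ≤ massNum (stepD d) m
massNum-stepD m [] = ≤-refl
massNum-stepD {(p , t) ∷ d} m ((h , _ , e) ∷ g) =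
  subst (λ e → massNum ((p , t) ∷ d) m ≤ massNum e m) (sym (stepD-∷ p t d)) entry
  where
  open ≤-Reasoning
  entry : massNum ((p , t) ∷ d) m ≤ massNum (scale p (step t) ++ stepD d) m
  entry with maybe-≡-dec _≟_ (numVal t) (just m)
  ... | no _   = ≤-trans (massNum-stepD m g) (massNum-++-≤ (scale p (step t)) m (step-terminating h (unfold e)))
  ... | yes eq with refl ← numVal⇒num t eq = begin
    p + massNum d m                                         ≤⟨ +-monoʳ-≤ p (massNum-stepD m g) ⟩
    p + massNum (stepD d) m                                 ≡⟨ massNum-hit p m (stepD d) ⟨
    massNum ((p , num m) ∷ stepD d) m
      ≡⟨ cong (λ q → massNum ((q , num m) ∷ stepD d) m) (*-identityʳ p) ⟨
    massNum (scale p ((1ℚ , num m) ∷ []) ++ stepD d) m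
      ≡⟨ cong (λ e → massNum (scale p e ++ stepD d) m) (step-num m) ⟨
    massNum (scale p (step (num m)) ++ stepD d) m           ∎

massNum-mono : ∀ {M a} m → M ⇓ a → ∀ j k → massNum (μ M k) m ≤ massNum (μ M (j ℕ.+ k)) m
massNum-mono m e zero    k = ≤-refl
massNum-mono m e (suc j) k = ≤-trans (massNum-mono m e j k) (massNum-stepD m (μ-terminating e (j ℕ.+ k)))

massNum-nonneg : ∀ {d} m → All Terminating d → 0ℚ ≤ massNum d m
massNum-nonneg {d} m g = subst (λ d → 0ℚ ≤ massNum d m) (++-identityʳ d) (massNum-++-≤ d m g)

∈⇒≤massNum : ∀ {d p m} → All Terminating d → (p , num m) ∈ d → p ≤ massNum d m
∈⇒≤massNum {_ ∷ d} {p} {m} (_ ∷ g) (here refl) rewrite massNum-hit p m d =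
  ≤-trans (≤-reflexive (sym (+-identityʳ p))) (+-monoʳ-≤ p (massNum-nonneg m g))
∈⇒≤massNum {m = m} (x ∷ g) (there i) = ≤-trans (∈⇒≤massNum g i) (massNum-++-≤ (_ ∷ []) m (x ∷ []))

-- Each entry counts towards at most one of the three masses. They will be those of the right
-- success, of failure and of a supposed wrong success.
massNum₃≤total : ∀ {d} x y z → x ≢ y → x ≢ z → y ≢ z → All Terminating d →
                 (massNum d x + massNum d y) + massNum d z ≤ total d
massNum₃≤total x y z x≢y x≢z y≢z [] = ≤-refl
massNum₃≤total {(p , t) ∷ d} x y z x≢y x≢z y≢z ((h , _) ∷ g)
  with maybe-≡-dec _≟_ (numVal t) (just x) | maybe-≡-dec _≟_ (numVal t) (just y)
     | maybe-≡-dec _≟_ (numVal t) (just z) | massNum₃≤total x y z x≢y x≢z y≢z g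
... | yes u | yes v | _     | _  = contradiction (just-injective (trans (sym u) v)) x≢y
... | yes u | _     | yes w | _  = contradiction (just-injective (trans (sym u) w)) x≢z
... | _     | yes v | yes w | _  = contradiction (just-injective (trans (sym v) w)) y≢z
... | no _  | no _  | no _  | ih =
  ≤-trans ih (≤-trans (≤-reflexive (sym (+-identityˡ _))) (+-monoˡ-≤ (total d) h))
... | yes _ | no _  | no _  | ih = ≤-trans (≤-reflexive
  (solve 4 (λ p a b c → (p :+ a :+ b) :+ c := p :+ ((a :+ b) :+ c))
    refl p (massNum d x) (massNum d y) (massNum d z)))
  (+-monoʳ-≤ p ih)
  where open +-*-Solver
... | no _  | yes _ | no _  | ih = ≤-trans (≤-reflexive
  (solve 4 (λ p a b c → (a :+ (p :+ b)) :+ c := p :+ ((a :+ b) :+ c))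
    refl p (massNum d x) (massNum d y) (massNum d z)))
  (+-monoʳ-≤ p ih)
  where open +-*-Solver
... | no _  | no _  | yes _ | ih = ≤-trans (≤-reflexive
  (solve 4 (λ p a b c → (a :+ b) :+ (p :+ c) := p :+ ((a :+ b) :+ c))
    refl p (massNum d x) (massNum d y) (massNum d z)))
  (+-monoʳ-≤ p ih)
  where open +-*-Solver

-- Positive leaves and answers

stepD-∈ : ∀ {d p t q u} → (p , t) ∈ d → (q , u) ∈ step t → (p * q , u) ∈ stepD d
stepD-∈ {(p , t) ∷ d} (here refl) j =
  subst (_ ∈_) (sym (stepD-∷ p t d)) (∈-++⁺ˡ (∈-map⁺ (λ e → p * proj₁ e , proj₂ e) j))
stepD-∈ {(p , t) ∷ d} (there i) j =
  subst (_ ∈_) (sym (stepD-∷ p t d)) (∈-++⁺ʳ (scale p (step t)) (stepD-∈ i j))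

Reaches : Term → Term → Set
Reaches M V = ∃[ k ] Σ[ p ∈ ℚ ] (0ℚ < p × (p , V) ∈ μ M k)

-- Follow the branch that `orElse` selects: left if its answer is nonzero, right otherwise. A choice
-- only halves the weight, which stays positive.
⇓-reaches : ∀ {M t a b} → t ⇓ a → a ≡ suc b → Reaches M t → Reaches M (num (suc b))
⇓-reaches (done _) refl r = r
⇓-reaches (one s e) eq (k , p , 0<p , i) = ⇓-reaches e eq
  (suc k , p * 1ℚ , 0<* 0<p 0<1 , stepD-∈ i (subst (_ ∈_) (sym (step-nonvalue s)) (here refl)))
⇓-reaches (two {a = suc _} s e₁ e₂) eq (k , p , 0<p , i) = ⇓-reaches e₁ eq
  (suc k , p * ½ , 0<* 0<p 0<½ , stepD-∈ i (subst (_ ∈_) (sym (step-nonvalue s)) (here refl)))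
⇓-reaches (two {a = zero} s e₁ e₂) eq (k , p , 0<p , i) = ⇓-reaches e₂ eq
  (suc k , p * ½ , 0<* 0<p 0<½ , stepD-∈ i (subst (_ ∈_) (sym (step-nonvalue s)) (there (here refl))))

leaf-persists : ∀ {M p n k} → (p , num n) ∈ μ M k → ∀ j → (p , num n) ∈ μ M (j ℕ.+ k)
leaf-persists i zero = i
leaf-persists {M} {p} {n} {k} i (suc j) =
  subst (λ q → (q , num n) ∈ μ M (suc j ℕ.+ k)) (*-identityʳ p)
    (stepD-∈ (leaf-persists i j) (subst ((1ℚ , num n) ∈_) (sym (step-num n)) (here refl)))

Failing : ℚ × Term → Set
Failing (_ , t) = t ⇓ 0

step-failing : ∀ p {t a d} → Unfold t a d → a ≡ 0 → All Failing (scale p d)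
step-failing p (stay a refl)        refl = done 0 ∷ []
step-failing p (move e)             refl = e ∷ []
step-failing p (split {a = zero} e₁ e₂) refl = e₁ ∷ e₂ ∷ []

stepD-failing : ∀ {d} → All Failing d → All Failing (stepD d)
stepD-failing [] = []
stepD-failing {(p , t) ∷ d} (e ∷ g) =
  subst (All Failing) (sym (stepD-∷ p t d)) (++⁺ (step-failing p (unfold e) refl) (stepD-failing g))

μ-failing : ∀ {M} → M ⇓ 0 → ∀ k → All Failing (μ M k)
μ-failing e zero    = e ∷ []
μ-failing e (suc k) = stepD-failing (μ-failing e k)

failing-massNum : ∀ {d} m → All Failing d → massNum d (suc m) ≡ 0ℚ
failing-massNum m [] = refl
failing-massNum {(p , t) ∷ d} m (e ∷ g) with maybe-≡-dec _≟_ (numVal t) (just (suc m))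
... | yes eq = contradiction (⇓-num e (numVal⇒num t eq)) λ ()
... | no _   = failing-massNum m g

-- With answer 0 every branch fails, and `S m` never gets any mass. With answer `S b` for `b ≢ m`, a
-- leaf of positive mass `q` stays forever, while the masses of `S m` and 0 together come
-- arbitrarily close to 1: more than the total allows.
lv-answer : ∀ {M a} m → M ⇓ a → LimGe (λ k → massNum (μ M k) (suc m) + massNum (μ M k) 0) 1ℚ →
            LimPos (λ k → massNum (μ M k) (suc m)) → ℕ.pred a ≡ m
lv-answer {a = zero} m e _ (k , pos) = contradiction pos (<-irrefl (sym (failing-massNum m (μ-failing e k))))
lv-answer {M} {suc b} m e lim _ with b ≟ m
... | yes b≡m = b≡m
... | no b≢m with ⇓-reaches e refl (0 , 1ℚ , 0<1 , here refl)
-- The limit supplies only a stage at which the two masses reach `1ℚ - r`; taking `r` strictly below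
-- `q` makes the sum with `q` exceed 1.
... | K , q , 0<q , i with <-dense 0<q
... | r , 0<r , r<q with lim r 0<r
... | k , near = contradiction 1<1 (<-irrefl refl)
  where
  open ≤-Reasoning
  mass : ℕ → ℕ → ℚ
  mass j n = massNum (μ M j) n
  -- The leaf appears at stage `K`, the near-limit masses at stage `k`; persistence and monotonicity
  -- bring both to stage `K ℕ.+ k`.
  leaf : (q , num (suc b)) ∈ μ M (K ℕ.+ k)
  leaf = subst (λ j → (q , num (suc b)) ∈ μ M j) (ℕ.+-comm k K) (leaf-persists i k)
  1<1 : 1ℚ < 1ℚ
  1<1 = begin-strict
    1ℚ             ≡⟨ solve 1 (λ r → con 1ℚ := con 1ℚ :- r :+ r) refl r ⟩
    (1ℚ - r) + r   <⟨ +-monoʳ-< (1ℚ - r) r<q ⟩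
    (1ℚ - r) + q   ≤⟨ +-mono-≤
                        (≤-trans near (+-mono-≤ (massNum-mono (suc m) e K k) (massNum-mono 0 e K k)))
                        (∈⇒≤massNum (μ-terminating e (K ℕ.+ k)) leaf) ⟩
    (mass (K ℕ.+ k) (suc m) + mass (K ℕ.+ k) 0) + mass (K ℕ.+ k) (suc b)
                   ≤⟨ massNum₃≤total (suc m) 0 (suc b) (λ ()) (λ eq → b≢m (sym (ℕ.suc-injective eq))) (λ ())
                        (μ-terminating e (K ℕ.+ k)) ⟩
    total (μ M (K ℕ.+ k)) ≡⟨ μ-total e (K ℕ.+ k) ⟩
    1ℚ             ∎
    where open +-*-Solver

-- The classes of functions

-- `μ` adds its steps at the end, so detaching the first one takes an induction. The weight
-- `1ℚ * 1ℚ` computes to `1ℚ`, giving the literal equality that `DT` asks for.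
μ-⟶ : ∀ {M N} → M ⟶ N → ∀ k → μ M (suc k) ≡ μ N k
μ-⟶ {M} s zero    = trans (stepD-∷ 1ℚ M []) (cong (λ d → scale 1ℚ d ++ []) (step-nonvalue s))
μ-⟶ {M} s (suc k) = cong stepD (μ-⟶ s k)

μ-⟶* : ∀ {M N} → M ⟶* N → ∃[ k ] μ M k ≡ (1ℚ , N) ∷ []
μ-⟶* ε = 0 , refl
μ-⟶* (s ◅ r) with μ-⟶* r
... | k , eq = suc k , trans (μ-⟶ s k) eq

NDC⊕⇒DT : ∀ {f} → NDC⊕ f → DT f
NDC⊕⇒DT {f} (M , (⊢M , lim) , pos) = extract M , extract-typed ⊢M , extract-choiceFree M , λ n →
  let a , e , r = extract-correct ⊢M n in
  subst (λ m → ∃[ k ] μ (app (extract M) (num n)) k ≡ (1ℚ , num m) ∷ [])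
    (lv-answer (f n) e (lim n) (pos n)) (μ-⟶* r)

LimGe⇒LimPos : ∀ {s q} → 0ℚ < q → LimGe s q → LimPos s
LimGe⇒LimPos {s} {q} 0<q lim with <-dense 0<q
... | r , 0<r , r<q with lim r 0<r
... | k , near = k , (begin-strict
  0ℚ     ≡⟨ solve 1 (λ r → con 0ℚ := r :- r) refl r ⟩
  r - r  <⟨ +-monoˡ-< (- r) r<q ⟩
  q - r  ≤⟨ near ⟩
  s k    ∎)
  where
  open ≤-Reasoning
  open +-*-Solver

LV⊕⇒NDC⊕ : ∀ {f} → LV⊕ f → NDC⊕ f
LV⊕⇒NDC⊕ (M , lv , lim) = M , lv , λ n → LimGe⇒LimPos (positive⁻¹ (ℤ.+ 1 / 3)) (lim n)

recipℕ-pos : ∀ m (m≢0 : m ≢ 0) → 0ℚ < recipℕ m m≢0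
recipℕ-pos m m≢0 = positive⁻¹ _ {{normalize-pos 1 m {{ℕ.≢-nonZero m≢0}}}}

LVf⊕⇒NDC⊕ : ∀ {f} → LVf⊕ f → NDC⊕ f
LVf⊕⇒NDC⊕ (h , _ , h≢0 , M , lv , lim) = M , lv , λ n → LimGe⇒LimPos (recipℕ-pos (h n) (h≢0 n)) (lim n)

-- From System T to Las Vegas computation

step-app-suc : ∀ t → step (app sucT t) ≡ pushforward (app sucT) (step t)
step-app-suc t with isVal t
... | true  = refl
... | false = refl

-- `DT` provides a final distribution, not a sequence of `_⟶_` steps to which `plug*` would apply;
-- so the successor is shown to commute with `μ` itself, stage by stage.
μ-app-suc : ∀ M k → μ (app sucT M) k ≡ pushforward (app sucT) (μ M k)
μ-app-suc M zero = refl
μ-app-suc M (suc k) = trans (cong stepD (μ-app-suc M k)) (stepD-pushforward (μ M k))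
  where
  S : Dist → Dist
  S = pushforward (app sucT)
  pushforward-++ : ∀ d e → S (d ++ e) ≡ S d ++ S e
  pushforward-++ []      e = refl
  pushforward-++ (_ ∷ d) e = cong (_ ∷_) (pushforward-++ d e)
  pushforward-scale : ∀ p d → scale p (S d) ≡ S (scale p d)
  pushforward-scale p []      = refl
  pushforward-scale p (_ ∷ d) = cong (_ ∷_) (pushforward-scale p d)
  stepD-pushforward : ∀ d → stepD (S d) ≡ S (stepD d)
  stepD-pushforward [] = refl
  stepD-pushforward ((p , t) ∷ d) = begin
    stepD (S ((p , t) ∷ d))                       ≡⟨ stepD-∷ p (app sucT t) (S d) ⟩
    scale p (step (app sucT t)) ++ stepD (S d)    ≡⟨ cong₂ (λ x y → scale p x ++ y) (step-app-suc t) (stepD-pushforward d) ⟩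
    scale p (S (step t)) ++ S (stepD d)           ≡⟨ cong (_++ S (stepD d)) (pushforward-scale p (step t)) ⟩
    S (scale p (step t)) ++ S (stepD d)           ≡⟨ pushforward-++ (scale p (step t)) (stepD d) ⟨
    S (scale p (step t) ++ stepD d)               ≡⟨ cong S (stepD-∷ p t d) ⟨
    S (stepD ((p , t) ∷ d))                       ∎
    where open ≡-Reasoning

eventually : ∀ {s : ℕ → ℚ} {q} → ∃[ k ] q ≤ s k → LimGe s q
eventually {s} {q} (k , h) r 0<r = k , ≤-trans
  (subst (q - r ≤_) (+-identityʳ q) (+-monoʳ-≤ q (<⇒≤ (neg-antimono-< 0<r)))) h

weaken : ∀ {Γ Δ M σ} → (∀ {x τ} → Γ ∋ x ∶ τ → Δ ∋ x ∶ τ) → Γ ⊢ M ∶ σ → Δ ⊢ M ∶ σ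
weaken w (⊢var x)    = ⊢var (w x)
weaken w (⊢lam M)    = ⊢lam (weaken (λ { here → here ; (there y≢x y) → there y≢x (w y) }) M)
weaken w (⊢app M N)  = ⊢app (weaken w M) (weaken w N)
weaken w (⊢pair M N) = ⊢pair (weaken w M) (weaken w N)
weaken w ⊢π₁         = ⊢π₁
weaken w ⊢π₂         = ⊢π₂
weaken w ⊢rec        = ⊢rec
weaken w ⊢zero       = ⊢zero
weaken w ⊢suc        = ⊢suc
weaken w (⊢⊕ M N)    = ⊢⊕ (weaken w M) (weaken w N)

DT⇒sure-success : ∀ {f} → DT f → ∃[ M ] ([] ⊢ M ∶ nat ⇒ nat ×
                  (∀ n → ∃[ k ] μ (app M (num n)) k ≡ (1ℚ , num (suc (f n))) ∷ []))
DT⇒sure-success {f} (M , ⊢M , _ , computes) = M′ , ⊢M′ , λ n →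
  let k , eq = computes n
      s = subst (λ t → app M′ (num n) ⟶ app sucT (app t (num n))) (sub-id _ ⊢M)
            (⟶-β-closed ⊢M′ (num-closedVal n))
  in suc k , trans (μ-⟶ s k) (trans (μ-app-suc (app M (num n)) k) (cong (pushforward (app sucT)) eq))
  where
  M′ : Term
  M′ = lam 0 (app sucT (app M (var 0)))
  ⊢M′ : [] ⊢ M′ ∶ nat ⇒ nat
  ⊢M′ = ⊢lam (⊢app ⊢suc (⊢app (weaken (λ ()) ⊢M) ⊢v₀))

DT⇒LV : ∀ {f q} → q ≤ 1ℚ → DT f →
        ∃[ M ] (LVcomputes M f × (∀ n → LimGe (succMass M f n) q))
DT⇒LV {f} {q} q≤1 df with DT⇒sure-success df
... | M , ⊢M , sure = M ,
  (⊢M , λ n → let k , eq = sure n in eventually (k ,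
    subst (λ d → 1ℚ ≤ massNum d (suc (f n)) + massNum d 0) (sym eq)
      (+-mono-≤ (success n) (massNum-nonneg 0 (terminating n))))) ,
  λ n → let k , eq = sure n in eventually (k ,
    ≤-trans q≤1 (subst (λ d → 1ℚ ≤ massNum d (suc (f n))) (sym eq) (success n)))
  where
  terminating : ∀ n → All Terminating ((1ℚ , num (suc (f n))) ∷ [])
  terminating n = (<⇒≤ 0<1 , _ , done (suc (f n))) ∷ []
  success : ∀ n → 1ℚ ≤ massNum ((1ℚ , num (suc (f n))) ∷ []) (suc (f n))
  success n = ∈⇒≤massNum (terminating n) (here refl)

DT⇒LV⊕ : ∀ {f} → DT f → LV⊕ f
DT⇒LV⊕ = DT⇒LV (toWitness {a? = ℤ.+ 1 / 3 ≤? 1ℚ} _)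

DT-one : DT (const 1)
DT-one = lam 0 (num 1) , ⊢lam (⊢app ⊢suc ⊢zero) , refl , λ n →
  μ-⟶* (⟶-β closedEnv-closed 0 (num 1) (num-closedVal n) ◅ ε)

DT⇒LVf⊕ : ∀ {f} → DT f → LVf⊕ f
-- Success is certain, so the constant 1 serves as the bound `h`.
DT⇒LVf⊕ df = const 1 , DT-one , (λ _ ()) , DT⇒LV ≤-refl df

mainTheorem10 : ((f : ℕ → ℕ) → NDC⊕ f ⇔ DT f)
    × ((f : ℕ → ℕ) → LV⊕ f ⇔ DT f)
    × ((f : ℕ → ℕ) → LVf⊕ f ⇔ DT f)
mainTheorem10 =
  (λ f → mk⇔ NDC⊕⇒DT (LV⊕⇒NDC⊕ ∘ DT⇒LV⊕)) ,
  (λ f → mk⇔ (NDC⊕⇒DT ∘ LV⊕⇒NDC⊕) DT⇒LV⊕) ,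
  (λ f → mk⇔ (NDC⊕⇒DT ∘ LVf⊕⇒NDC⊕) DT⇒LVf⊕)
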